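{- Let $m(N,d)$ denote the number of maximum classes $C\subseteq\{\pm1\}^N$ of VC dimension $d$. For every $d>1$ there is $N_0=N_0(d)$ such that for all $N>N_0$, $$N^{(1+o(1))\frac{1}{d+1}\binom{N}{d}}\leq m(N,d)\leq N^{(1+o(1))\sum_{i=1}^d\binom{N}{i}}.$$
   Context: The VC dimension of a class $C\subseteq\{\pm1\}^N$ is the maximum size of a set of coordinates $Y\subseteq[N]$ such that every pattern in $\{\pm1\}^Y$ is the restriction of some member of $C$ to $Y$. A class of VC dimension $d$ is maximum if $|C|=\sum_{i=0}^d\binom{N}{i}$. The $o(1)$ terms tend to $0$ as $N\to\infty$ with $d$ fixed. -}

module Defs where

open import Data.Bool using (Bool; true; false)
open import Data.Bool.Properties using () renaming (_≟_ to _≟ᵇ_)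
open import Data.Nat using (ℕ; zero; suc; _≤_; _≤?_)
open import Data.Nat.Properties using () renaming (_≟_ to _≟ℕ_)
open import Data.Nat.Combinatorics using (_C_)
open import Data.Fin using (Fin)
open import Data.Fin.Properties using (all?)
open import Data.Fin.Subset using (Subset; ∣_∣)
open import Data.Vec using (Vec; []; _∷_; lookup)
open import Data.List using (List; []; _∷_; [_]; map; _++_; length; filter; upTo)
open import Data.Nat.ListAction using (sum)
open import Data.List.Relation.Unary.All using (All)
open import Data.List.Relation.Unary.All.Properties using ()
import Data.List.Relation.Unary.All as All
open import Data.List.Relation.Unary.Any using (Any)
import Data.List.Relation.Unary.Any as Any
open import Data.Product using (_×_)
open import Relation.Binary.PropositionalEquality using (_≡_)
open import Relation.Nullary using (Dec)
open import Relation.Nullary.Decidable using (_×-dec_; _→-dec_)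

-- A point of {±1}^N is encoded as a Bool-vector of length N (true = +1, false = -1).
Cube : ℕ → Set
Cube N = Vec Bool N

allVecs : (N : ℕ) → List (Vec Bool N)
allVecs zero = [ [] ]
allVecs (suc N) = map (true ∷_) (allVecs N) ++ map (false ∷_) (allVecs N)

-- All sublists (subsequences) of a list; applied to a duplicate-free list
-- this enumerates every subset exactly once.
sublists : ∀ {a} {A : Set a} → List A → List (List A)
sublists [] = [ [] ]
sublists (x ∷ xs) = map (x ∷_) (sublists xs) ++ sublists xs

-- A class C ⊆ {±1}^N, given as a duplicate-free list of its members.
Class : ℕ → Set
Class N = List (Cube N)

AgreeOn : ∀ {N} → Subset N → Cube N → Cube N → Set
AgreeOn {N} Y c p = ∀ (i : Fin N) → lookup Y i ≡ true → lookup c i ≡ lookup p i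

Shatters : ∀ {N} → Class N → Subset N → Set
Shatters {N} 𝒞 Y = All (λ p → Any (λ c → AgreeOn Y c p) 𝒞) (allVecs N)

HasVCdim : ∀ {N} → Class N → ℕ → Set
HasVCdim {N} 𝒞 d =
  Any (λ Y → ∣ Y ∣ ≡ d × Shatters 𝒞 Y) (allVecs N) ×
  All (λ Y → Shatters 𝒞 Y → ∣ Y ∣ ≤ d) (allVecs N)

binomSum : ℕ → ℕ → ℕ
binomSum N d = sum (map (N C_) (upTo (suc d)))

binomSum₁ : ℕ → ℕ → ℕ
binomSum₁ N d = sum (map (λ i → N C suc i) (upTo d))

IsMaximum : ∀ {N} → ℕ → Class N → Set
IsMaximum {N} d 𝒞 = HasVCdim 𝒞 d × length 𝒞 ≡ binomSum N d

agreeOn? : ∀ {N} (Y c p : Cube N) → Dec (AgreeOn Y c p)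
agreeOn? Y c p = all? (λ i → (lookup Y i ≟ᵇ true) →-dec (lookup c i ≟ᵇ lookup p i))

shatters? : ∀ {N} (𝒞 : Class N) (Y : Subset N) → Dec (Shatters 𝒞 Y)
shatters? {N} 𝒞 Y = All.all? (λ p → Any.any? (λ c → agreeOn? Y c p) 𝒞) (allVecs N)

isMaximum? : ∀ {N} (d : ℕ) (𝒞 : Class N) → Dec (IsMaximum d 𝒞)
isMaximum? {N} d 𝒞 =
  (Any.any? (λ Y → (∣ Y ∣ ≟ℕ d) ×-dec shatters? 𝒞 Y) (allVecs N)
    ×-dec All.all? (λ Y → shatters? 𝒞 Y →-dec (∣ Y ∣ ≤? d)) (allVecs N))
  ×-dec (length 𝒞 ≟ℕ binomSum N d)

m : ℕ → ℕ → ℕ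
m N d = length (filter (isMaximum? d) (sublists (allVecs N)))

{-# OPTIONS --safe #-}
-- Upper bound. A maximum class on N+1 coordinates projects to a maximum class, and every edge
-- of the projection (two members differing in one coordinate) lifts to the class: the lifted and
-- the unlifted edges in a given direction both form maximum classes with the same parameters,
-- hence have the same size. By induction a maximum class induces a connected subgraph of the
-- cube, so it is determined by a root and a depth-first walk along a spanning tree. With
-- K = Σ_{i=1}^d C(N,i) edges this gives m ≤ 2^N · 4^K · N^K.
--
-- Lower bound. Let D be the d-subsets of [N] with element sum ≡ r (mod d+1), and move each A ∈ D
-- in the radius-d Hamming ball to A ∪ {x}, where the residue of x modulo d+1 does not occur in A.
-- Then A ∪ {x} contains no other member of D, which makes the resulting class maximum and lets one
-- read off all the choices of x. Each A has at least q = ⌊N/(d+1)⌋ choices, and multiplying over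
-- all residues r gives q^C(N,d) ≤ m^(d+1).
module Submission where

open import Defs
open import Algebra.Properties.CommutativeSemigroup using (interchange)
open import Data.Bool using (Bool; true; false; _∧_; _∨_; not; if_then_else_)
open import Data.Bool.Properties using (¬-not) renaming (_≟_ to _≟ᵇ_)
open import Data.Empty using (⊥-elim)
open import Data.Fin as Fin using (Fin; zero; suc; toℕ; fromℕ<)
open import Data.Fin.Properties using (toℕ-fromℕ<; toℕ-injective; toℕ<n)
open import Data.Fin.Subset using (Subset; ∣_∣)
open import Data.List using (List; []; _∷_; [_]; map; _++_; length; filter; upTo; allFin; tabulate; cartesianProductWith)
open import Data.List.Membership.Propositional using (_∈_; _∉_; find; lose)
open import Data.List.Membership.Propositional.Properties
import Data.List.Membership.DecPropositional as DecMembership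
open import Data.List.Properties using (∷-injectiveʳ; length-++; length-map; length-tabulate; length-upTo; map-++; upTo-∷ʳ; filter-++; filter-accept; filter-reject; filter-all; filter-none; ++-assoc; ++-identityʳ)
open import Data.List.Relation.Binary.Permutation.Propositional using (_↭_; prep; swap; ↭-refl; ↭-sym; ↭-trans; ↭⇒↭ₛ)
open import Data.List.Relation.Binary.Permutation.Propositional.Properties using (shift; ++⁺ˡ; ++⁺ʳ; ↭-length; ∈-resp-↭)
import Data.List.Relation.Binary.Permutation.Setoid.Properties as SetoidPerm
open import Data.List.Relation.Binary.Subset.Propositional using (_⊆_)
open import Data.List.Relation.Unary.All as All using (All; []; _∷_)
import Data.List.Relation.Unary.All.Properties as All
open import Data.List.Relation.Unary.AllPairs as AllPairs using (AllPairs; []; _∷_)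
import Data.List.Relation.Unary.AllPairs.Properties as AllPairs
open import Data.List.Relation.Unary.Any as Any using (Any; here; there)
open import Data.List.Relation.Unary.Unique.Propositional using (Unique)
import Data.List.Relation.Unary.Unique.Propositional.Properties as Unique
open import Data.Maybe using (Maybe; just; nothing)
open import Data.Nat using (ℕ; zero; suc; pred; _+_; _*_; _∸_; _^_; _/_; _%_; _≤_; _<_; z≤n; s≤s; _≡ᵇ_; _<ᵇ_; _≟_; _<?_; _≤?_; NonZero; >-nonZero)
open import Data.Nat.Combinatorics using (_C_; nCk+nC[k+1]≡[n+1]C[k+1]; nCk≡nC[n∸k]; nCn≡1; nC1≡n)
open import Data.Nat.DivMod using (m%n<n; [m+kn]%n≡m%n; m/n*n≤m; m*n/n≡m; /-monoˡ-≤; m<n⇒m%n≡m; m≡m%n+[m/n]*n)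
open import Data.Nat.ListAction using (sum)
open import Data.Nat.ListAction.Properties using (sum-++)
open import Data.Nat.Properties hiding (_≟_; _<?_; _≤?_)
open import Data.Product using (_×_; _,_; ∃-syntax; proj₁; proj₂)
open import Data.Sum using (inj₁; inj₂)
open import Data.Vec using ([]; _∷_; lookup; insertAt; removeAt; updateAt; _[_]≔_)
open import Data.Vec.Properties using (≡-dec; lookup∘update; lookup∘update′) renaming (∷-injectiveʳ to ∷ᵛ-injectiveʳ)
open import Function using (_∘_; id)
open import Relation.Binary using (DecidableEquality)
open import Relation.Binary.Construct.Closure.ReflexiveTransitive using (Star; ε; _◅_; _◅◅_)
open import Relation.Binary.PropositionalEquality hiding ([_])
open import Relation.Nullary using (Dec; yes; no; does; ¬_)
open import Relation.Nullary.Decidable using (dec-true; _×-dec_)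

module _ {a} {A : Set a} where

  extract : ∀ {x : A} {ys} → x ∈ ys →
    ∃[ zs ] length ys ≡ suc (length zs) × (∀ {z} → z ∈ ys → z ≢ x → z ∈ zs)
  extract {ys = _ ∷ ys} (here refl) = ys , refl , λ where
    (here eq) z≢x → ⊥-elim (z≢x eq)
    (there z∈) _ → z∈
  extract {ys = y ∷ ys} (there x∈) with extract x∈
  ... | zs , eq , f = y ∷ zs , cong suc eq , λ where
    (here e) _ → here e
    (there z∈) z≢x → there (f z∈ z≢x)

  unique-⊆-length : ∀ {xs ys : List A} → Unique xs → xs ⊆ ys → length xs ≤ length ys
  unique-⊆-length {[]} _ _ = z≤n
  unique-⊆-length {x ∷ xs} {ys} (x∉ ∷ u) sub with extract (sub (here refl))
  ... | zs , eq , f rewrite eq =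
    s≤s (unique-⊆-length u λ z∈ → f (sub (there z∈)) λ z≡x → All.lookup x∉ z∈ (sym z≡x))

  sublists-⊆ : ∀ (xs : List A) {c} → c ∈ sublists xs → c ⊆ xs
  sublists-⊆ [] (here refl) = λ ()
  sublists-⊆ (x ∷ xs) c∈ with ∈-++⁻ (map (x ∷_) (sublists xs)) c∈
  ... | inj₂ c∈′ = there ∘ sublists-⊆ xs c∈′
  ... | inj₁ c∈′ with ∈-map⁻ (x ∷_) c∈′
  ... | _ , c′∈ , refl = λ where
    (here eq) → here eq
    (there z∈) → there (sublists-⊆ xs c′∈ z∈)

  sublists-unique : ∀ {xs : List A} → Unique xs → Unique (sublists xs)
  sublists-unique {[]} _ = [] ∷ []
  sublists-unique {x ∷ xs} (x∉ ∷ u) =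
    Unique.++⁺ (Unique.map⁺ ∷-injectiveʳ (sublists-unique u)) (sublists-unique u) disjoint
    where
    disjoint : ∀ {c} → ¬ (c ∈ map (x ∷_) (sublists xs) × c ∈ sublists xs)
    disjoint (p , q) with ∈-map⁻ (x ∷_) p
    ... | _ , _ , refl = All.lookup x∉ (sublists-⊆ xs q (here refl)) refl

  filter∈sublists : ∀ {p} {P : A → Set p} (P? : ∀ x → Dec (P x)) xs → filter P? xs ∈ sublists xs
  filter∈sublists P? [] = here refl
  filter∈sublists P? (x ∷ xs) with P? x
  ... | yes _ = ∈-++⁺ˡ (∈-map⁺ (x ∷_) (filter∈sublists P? xs))
  ... | no _ = ∈-++⁺ʳ (map (x ∷_) (sublists xs)) (filter∈sublists P? xs)

  filter-cong : ∀ {p q} {P : A → Set p} {Q : A → Set q} (P? : ∀ x → Dec (P x)) (Q? : ∀ x → Dec (Q x)) xs →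
    (∀ {x} → x ∈ xs → P x → Q x) → (∀ {x} → x ∈ xs → Q x → P x) → filter P? xs ≡ filter Q? xs
  filter-cong P? Q? [] f g = refl
  filter-cong P? Q? (x ∷ xs) f g with P? x | Q? x | filter-cong P? Q? xs (f ∘ there) (g ∘ there)
  ... | yes _ | yes _ | eq = cong (x ∷_) eq
  ... | yes p | no ¬q | _ = ⊥-elim (¬q (f (here refl) p))
  ... | no ¬p | yes q | _ = ⊥-elim (¬p (g (here refl) q))
  ... | no _ | no _ | eq = eq

  module _ (_≟_ : DecidableEquality A) where
    open DecMembership _≟_ using (_∈?_)

    filter-∈-sublist : ∀ {xs c} → Unique xs → c ∈ sublists xs → filter (_∈? c) xs ≡ c
    filter-∈-sublist {[]} _ (here refl) = refl
    filter-∈-sublist {x ∷ xs} {c} (x∉ ∷ u) c∈ with ∈-++⁻ (map (x ∷_) (sublists xs)) c∈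
    ... | inj₂ c∈′ =
      trans (filter-reject (_∈? c) λ x∈c → All.lookup x∉ (sublists-⊆ xs c∈′ x∈c) refl)
            (filter-∈-sublist u c∈′)
    ... | inj₁ c∈′ with ∈-map⁻ (x ∷_) c∈′
    ... | c′ , c′∈ , refl =
      trans (filter-accept (_∈? (x ∷ c′)) (here refl))
      (cong (x ∷_) (trans
        (filter-cong (_∈? (x ∷ c′)) (_∈? c′) xs
          (λ where
            z∈ (here refl) → ⊥-elim (All.lookup x∉ z∈ refl)
            z∈ (there p) → p)
          (λ _ → there))
        (filter-∈-sublist u c′∈)))

    ∃-∉ : ∀ {xs ys : List A} → Unique xs → length ys < length xs → ∃[ x ] x ∈ xs × x ∉ ys
    ∃-∉ {xs} {ys} u lt with All.all? (_∈? ys) xs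
    ... | yes all = ⊥-elim (<⇒≱ lt (unique-⊆-length u (All.lookup all)))
    ... | no ¬all = find (All.¬All⇒Any¬ (_∈? ys) xs ¬all)

_≟ᶜ_ : ∀ {N} → DecidableEquality (Cube N)
_≟ᶜ_ = ≡-dec _≟ᵇ_

allVecs-complete : ∀ {N} (v : Cube N) → v ∈ allVecs N
allVecs-complete [] = here refl
allVecs-complete (true ∷ v) = ∈-++⁺ˡ (∈-map⁺ (true ∷_) (allVecs-complete v))
allVecs-complete {suc N} (false ∷ v) =
  ∈-++⁺ʳ (map (true ∷_) (allVecs N)) (∈-map⁺ (false ∷_) (allVecs-complete v))

allVecs-unique : ∀ N → Unique (allVecs N)
allVecs-unique zero = [] ∷ []
allVecs-unique (suc N) =
  Unique.++⁺ (Unique.map⁺ ∷ᵛ-injectiveʳ (allVecs-unique N)) (Unique.map⁺ ∷ᵛ-injectiveʳ (allVecs-unique N)) disjoint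
  where
  disjoint : ∀ {v} → ¬ (v ∈ map (true ∷_) (allVecs N) × v ∈ map (false ∷_) (allVecs N))
  disjoint (p , q) with ∈-map⁻ (true ∷_) p | ∈-map⁻ (false ∷_) q
  ... | _ , _ , refl | _ , _ , ()

length-allVecs : ∀ N → length (allVecs N) ≡ 2 ^ N
length-allVecs zero = refl
length-allVecs (suc N) = trans (length-++ (map (true ∷_) (allVecs N)))
  (cong₂ _+_ (trans (length-map (true ∷_) (allVecs N)) (length-allVecs N))
             (trans (trans (length-map (false ∷_) (allVecs N)) (length-allVecs N)) (sym (+-identityʳ _))))

-- Shattering and the Sauer–Shelah lemma

∧-true⁻ : ∀ {x y} → x ∧ y ≡ true → x ≡ true × y ≡ true
∧-true⁻ {true} {true} _ = refl , refl

∧-true⁺ : ∀ {x y} → x ≡ true → y ≡ true → x ∧ y ≡ true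
∧-true⁺ refl refl = refl

∨-true⁺ˡ : ∀ {x} y → x ≡ true → x ∨ y ≡ true
∨-true⁺ˡ _ refl = refl

∨-true⁺ʳ : ∀ x {y} → y ≡ true → x ∨ y ≡ true
∨-true⁺ʳ true _ = refl
∨-true⁺ʳ false eq = eq

∨-elim : ∀ {p} {P : Set p} x {y} → (x ≡ true → P) → (y ≡ true → P) → x ∨ y ≡ true → P
∨-elim true f _ _ = f refl
∨-elim false _ g eq = g eq

+-tight : ∀ {a b c d} → a ≤ c → b ≤ d → a + b ≡ c + d → a ≡ c × b ≡ d
+-tight {a} {b} {c} {d} a≤c b≤d eq = a≡c , b≡d
  where
  a≡c : a ≡ c
  a≡c = ≤-antisym a≤c (+-cancelʳ-≤ b c a (≤-trans (+-monoʳ-≤ c b≤d) (≤-reflexive (sym eq))))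
  b≡d : b ≡ d
  b≡d = +-cancelˡ-≡ a b d (trans eq (cong (_+ d) (sym a≡c)))

BClass : ℕ → Set
BClass N = Cube N → Bool

infix 4 _≼_
_≼_ : ∀ {N} → BClass N → BClass N → Set
χ ≼ ψ = ∀ v → χ v ≡ true → ψ v ≡ true

indicator : Bool → ℕ
indicator true = 1
indicator false = 0

size : ∀ {N} → BClass N → ℕ
size {zero} χ = indicator (χ [])
size {suc N} χ = size (λ v → χ (true ∷ v)) + size (λ v → χ (false ∷ v))

size-mono : ∀ {N} {χ ψ : BClass N} → χ ≼ ψ → size χ ≤ size ψ
size-mono {zero} {χ} {ψ} le with χ [] | le []
... | false | _ = z≤n
... | true | f rewrite f refl = ≤-refl
size-mono {suc N} le = +-mono-≤ (size-mono (λ v → le (true ∷ v))) (size-mono (λ v → le (false ∷ v)))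

≼-size-antisym : ∀ {N} {χ ψ : BClass N} → χ ≼ ψ → size χ ≡ size ψ → ψ ≼ χ
≼-size-antisym {zero} {χ} {ψ} le eq [] t with χ [] | ψ []
... | true | _ = refl
≼-size-antisym {zero} {χ} {ψ} le () [] refl | false | true
≼-size-antisym {suc N} {χ} {ψ} le eq (b ∷ v) t
  with +-tight (size-mono (λ v → le (true ∷ v))) (size-mono (λ v → le (false ∷ v))) eq
≼-size-antisym {suc N} le eq (true ∷ v) t | e , _ = ≼-size-antisym (λ v → le (true ∷ v)) e v t
≼-size-antisym {suc N} le eq (false ∷ v) t | _ , e = ≼-size-antisym (λ v → le (false ∷ v)) e v t

size-∨-∧ : ∀ {N} (χ ψ : BClass N) →
  size χ + size ψ ≡ size (λ v → χ v ∨ ψ v) + size (λ v → χ v ∧ ψ v)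
size-∨-∧ {zero} χ ψ with χ [] | ψ []
... | true | true = refl
... | true | false = refl
... | false | true = refl
... | false | false = refl
size-∨-∧ {suc N} χ ψ = begin
  (size χt + size χf) + (size ψt + size ψf)
    ≡⟨ interchange +-commutativeSemigroup (size χt) _ _ _ ⟩
  (size χt + size ψt) + (size χf + size ψf)
    ≡⟨ cong₂ _+_ (size-∨-∧ χt ψt) (size-∨-∧ χf ψf) ⟩
  (size (λ v → χt v ∨ ψt v) + size (λ v → χt v ∧ ψt v)) + (size (λ v → χf v ∨ ψf v) + size (λ v → χf v ∧ ψf v))
    ≡⟨ interchange +-commutativeSemigroup (size (λ v → χt v ∨ ψt v)) _ _ _ ⟩
  (size (λ v → χt v ∨ ψt v) + size (λ v → χf v ∨ ψf v)) + (size (λ v → χt v ∧ ψt v) + size (λ v → χf v ∧ ψf v)) ∎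
  where
  open ≡-Reasoning
  χt χf ψt ψf : BClass N
  χt v = χ (true ∷ v)
  χf v = χ (false ∷ v)
  ψt v = ψ (true ∷ v)
  ψf v = ψ (false ∷ v)

sh : ∀ {N} → Subset N → BClass N → Bool
sh [] χ = χ []
sh (true ∷ Y) χ = sh Y (λ v → χ (true ∷ v)) ∧ sh Y (λ v → χ (false ∷ v))
sh (false ∷ Y) χ = sh Y (λ v → χ (true ∷ v) ∨ χ (false ∷ v))

sh-mono : ∀ {N} (Y : Subset N) {χ ψ : BClass N} → χ ≼ ψ → sh Y χ ≡ true → sh Y ψ ≡ true
sh-mono [] le = le []
sh-mono (true ∷ Y) le s with ∧-true⁻ s
... | p , q = ∧-true⁺ (sh-mono Y (λ v → le (true ∷ v)) p) (sh-mono Y (λ v → le (false ∷ v)) q)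
sh-mono (false ∷ Y) {χ} {ψ} le =
  sh-mono Y λ v → ∨-elim (χ (true ∷ v)) (∨-true⁺ˡ _ ∘ le (true ∷ v)) (∨-true⁺ʳ (ψ (true ∷ v)) ∘ le (false ∷ v))

sh-∧ : ∀ {N} (Y : Subset N) (χ ψ : BClass N) →
  sh Y (λ v → χ v ∧ ψ v) ≡ true → sh Y χ ≡ true × sh Y ψ ≡ true
sh-∧ Y χ ψ s = sh-mono Y (λ v → proj₁ ∘ ∧-true⁻) s , sh-mono Y (λ v → proj₂ ∘ ∧-true⁻ {χ v}) s

-- Pajor's form of the Sauer–Shelah lemma.
size≤size-sh : ∀ {N} (χ : BClass N) → size χ ≤ size (λ Y → sh Y χ)
size≤size-sh {zero} χ = ≤-refl
size≤size-sh {suc N} χ = begin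
  size χt + size χf                                  ≡⟨ size-∨-∧ χt χf ⟩
  size χ∨ + size χ∧                                  ≡⟨ +-comm (size χ∨) (size χ∧) ⟩
  size χ∧ + size χ∨                                  ≤⟨ +-mono-≤ (size≤size-sh χ∧) (size≤size-sh χ∨) ⟩
  size (λ Y → sh Y χ∧) + size (λ Y → sh Y χ∨)        ≤⟨ +-monoˡ-≤ _ (size-mono λ Y s → ∧-true⁺ (proj₁ (sh-∧ Y χt χf s)) (proj₂ (sh-∧ Y χt χf s))) ⟩
  size (λ Y → sh (true ∷ Y) χ) + size (λ Y → sh Y χ∨) ∎
  where
  open ≤-Reasoning
  χt χf χ∨ χ∧ : BClass N
  χt v = χ (true ∷ v)
  χf v = χ (false ∷ v)
  χ∨ v = χt v ∨ χf v
  χ∧ v = χt v ∧ χf v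

sh-sound : ∀ {N} (Y : Subset N) (χ : BClass N) → sh Y χ ≡ true → ∀ p → ∃[ c ] χ c ≡ true × AgreeOn Y c p
sh-sound [] χ s p = [] , s , λ ()
sh-sound (true ∷ Y) χ s (true ∷ p) with sh-sound Y (λ v → χ (true ∷ v)) (proj₁ (∧-true⁻ s)) p
... | c , χc , ag = true ∷ c , χc , λ { zero _ → refl ; (suc i) → ag i }
sh-sound (true ∷ Y) χ s (false ∷ p)
  with sh-sound Y (λ v → χ (false ∷ v)) (proj₂ (∧-true⁻ {sh Y (λ v → χ (true ∷ v))} s)) p
... | c , χc , ag = false ∷ c , χc , λ { zero _ → refl ; (suc i) → ag i }
sh-sound (false ∷ Y) χ s (b ∷ p) with sh-sound Y _ s p
... | c , χc , ag =
  ∨-elim (χ (true ∷ c))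
    (λ e → true ∷ c , e , λ { zero () ; (suc i) → ag i })
    (λ e → false ∷ c , e , λ { zero () ; (suc i) → ag i }) χc

-- ball N e is the number of subsets of [N] of size less than e.
ball : ℕ → ℕ → ℕ
ball zero zero = 0
ball zero (suc _) = 1
ball (suc N) e = ball N (pred e) + ball N e

size≤ball : ∀ {N} e (χ : BClass N) → (∀ Y → χ Y ≡ true → ∣ Y ∣ < e) → size χ ≤ ball N e
size≤ball {zero} e χ f with χ [] | f []
... | false | _ = z≤n
... | true | g with e | g refl
... | suc _ | _ = ≤-refl
size≤ball {suc N} e χ f = +-mono-≤
  (size≤ball (pred e) _ λ Y t → <⇒≤pred (f (true ∷ Y) t))
  (size≤ball e _ λ Y → f (false ∷ Y))

VC< : ∀ {N} → ℕ → BClass N → Set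
VC< e χ = ∀ Y → sh Y χ ≡ true → ∣ Y ∣ < e

sauer : ∀ {N} e (χ : BClass N) → VC< e χ → size χ ≤ ball N e
sauer e χ vc = ≤-trans (size≤size-sh χ) (size≤ball e _ vc)

Max : ∀ {N} → ℕ → BClass N → Set
Max {N} e χ = VC< e χ × size χ ≡ ball N e

-- Connectivity of maximum classes

proj : ∀ {N} → Fin (suc N) → BClass (suc N) → BClass N
proj zero χ v = χ (true ∷ v) ∨ χ (false ∷ v)
proj {suc N} (suc i) χ (b ∷ v) = proj i (λ w → χ (b ∷ w)) v

red : ∀ {N} → Fin (suc N) → BClass (suc N) → BClass N
red zero χ v = χ (true ∷ v) ∧ χ (false ∷ v)
red {suc N} (suc i) χ (b ∷ v) = red i (λ w → χ (b ∷ w)) v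

size-proj-red : ∀ {N} i (χ : BClass (suc N)) → size χ ≡ size (red i χ) + size (proj i χ)
size-proj-red zero χ =
  trans (size-∨-∧ (λ v → χ (true ∷ v)) (λ v → χ (false ∷ v))) (+-comm (size (proj zero χ)) _)
size-proj-red {suc N} (suc i) χ =
  trans (cong₂ _+_ (size-proj-red i (λ v → χ (true ∷ v))) (size-proj-red i (λ v → χ (false ∷ v))))
        (interchange +-commutativeSemigroup (size (red i (λ v → χ (true ∷ v)))) _ _ _)

proj-mono : ∀ {N} i {χ ψ : BClass (suc N)} → χ ≼ ψ → proj i χ ≼ proj i ψ
proj-mono zero {χ} {ψ} le v =
  ∨-elim (χ (true ∷ v)) (∨-true⁺ˡ _ ∘ le (true ∷ v)) (∨-true⁺ʳ (ψ (true ∷ v)) ∘ le (false ∷ v))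
proj-mono {suc N} (suc i) le (b ∷ v) = proj-mono i (λ w → le (b ∷ w)) v

red-mono : ∀ {N} i {χ ψ : BClass (suc N)} → χ ≼ ψ → red i χ ≼ red i ψ
red-mono zero le v t with ∧-true⁻ t
... | p , q = ∧-true⁺ (le (true ∷ v) p) (le (false ∷ v) q)
red-mono {suc N} (suc i) le (b ∷ v) = red-mono i (λ w → le (b ∷ w)) v

sh-proj : ∀ {N} i (χ : BClass (suc N)) Y → sh Y (proj i χ) ≡ true → sh (insertAt Y i false) χ ≡ true
sh-proj zero χ Y s = s
sh-proj {suc N} (suc i) χ (true ∷ Y) s with ∧-true⁻ s
... | p , q = ∧-true⁺ (sh-proj i _ Y p) (sh-proj i _ Y q)
sh-proj {suc N} (suc i) χ (false ∷ Y) s =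
  sh-proj i _ Y (sh-mono Y (λ v → ∨-elim (proj i _ v)
    (proj-mono i (λ w → ∨-true⁺ˡ _) v) (proj-mono i (λ w → ∨-true⁺ʳ (χ (true ∷ w))) v)) s)

red-∨ : ∀ {N} i (χ : BClass (suc (suc N))) → proj zero (red (suc i) χ) ≼ red i (proj zero χ)
red-∨ i χ v = ∨-elim (red i (λ w → χ (true ∷ w)) v)
  (red-mono i (λ w → ∨-true⁺ˡ _) v) (red-mono i (λ w → ∨-true⁺ʳ (χ (true ∷ w))) v)

sh-red : ∀ {N} i (χ : BClass (suc N)) Y → sh Y (red i χ) ≡ true → sh (insertAt Y i true) χ ≡ true
sh-red zero χ Y s with sh-∧ Y (λ v → χ (true ∷ v)) (λ v → χ (false ∷ v)) s
... | p , q = ∧-true⁺ p q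
sh-red {suc N} (suc i) χ (true ∷ Y) s with ∧-true⁻ s
... | p , q = ∧-true⁺ (sh-red i _ Y p) (sh-red i _ Y q)
sh-red {suc N} (suc i) χ (false ∷ Y) s = sh-red i _ Y (sh-mono Y (red-∨ i χ) s)

∣insertAt-false∣ : ∀ {N} (Y : Subset N) i → ∣ insertAt Y i false ∣ ≡ ∣ Y ∣
∣insertAt-false∣ Y zero = refl
∣insertAt-false∣ (true ∷ Y) (suc i) = cong suc (∣insertAt-false∣ Y i)
∣insertAt-false∣ (false ∷ Y) (suc i) = ∣insertAt-false∣ Y i

∣insertAt-true∣ : ∀ {N} (Y : Subset N) i → ∣ insertAt Y i true ∣ ≡ suc ∣ Y ∣
∣insertAt-true∣ Y zero = refl
∣insertAt-true∣ (true ∷ Y) (suc i) = cong suc (∣insertAt-true∣ Y i)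
∣insertAt-true∣ (false ∷ Y) (suc i) = ∣insertAt-true∣ Y i

Max-red-proj : ∀ {N} i {e} {χ : BClass (suc N)} → Max e χ → Max (pred e) (red i χ) × Max e (proj i χ)
Max-red-proj {N} i {e} {χ} (vc , sz) = (vc-red , proj₁ tight) , (vc-proj , proj₂ tight)
  where
  vc-red : VC< (pred e) (red i χ)
  vc-red Y s = <⇒≤pred (subst (_< e) (∣insertAt-true∣ Y i) (vc (insertAt Y i true) (sh-red i χ Y s)))
  vc-proj : VC< e (proj i χ)
  vc-proj Y s = subst (_< e) (∣insertAt-false∣ Y i) (vc (insertAt Y i false) (sh-proj i χ Y s))
  tight : size (red i χ) ≡ ball N (pred e) × size (proj i χ) ≡ ball N e
  tight = +-tight (sauer _ _ vc-red) (sauer _ _ vc-proj) (trans (sym (size-proj-red i χ)) sz)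

flip : ∀ {N} → Fin N → Cube N → Cube N
flip i v = updateAt v i not

red⁺ : ∀ {N} i (χ : BClass (suc N)) u → χ u ≡ true → χ (flip i u) ≡ true → red i χ (removeAt u i) ≡ true
red⁺ zero χ (true ∷ u) p q = ∧-true⁺ p q
red⁺ zero χ (false ∷ u) p q = ∧-true⁺ q p
red⁺ (suc i) χ (b ∷ u@(_ ∷ _)) p q = red⁺ i (λ w → χ (b ∷ w)) u p q

red⁻ : ∀ {N} i (χ : BClass (suc N)) u → red i χ (removeAt u i) ≡ true → χ u ≡ true × χ (flip i u) ≡ true
red⁻ zero χ (true ∷ u) p = ∧-true⁻ p
red⁻ zero χ (false ∷ u) p with ∧-true⁻ p
... | a , b = b , a
red⁻ (suc i) χ (b ∷ u@(_ ∷ _)) p = red⁻ i (λ w → χ (b ∷ w)) u p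

-- Reduction commutes with projection: one inclusion is red-∨, and for a maximum class
-- both sides are maximum with the same parameters, hence of the same size.
edge-lifts : ∀ {N e} {χ : BClass (suc N)} → Max e χ → ∀ i u →
  proj zero χ u ≡ true → proj zero χ (flip i u) ≡ true →
  ∃[ b ] χ (b ∷ u) ≡ true × χ (b ∷ flip i u) ≡ true
edge-lifts {suc N} {e} {χ} mx i u p q =
  ∨-elim (red i (λ w → χ (true ∷ w)) (removeAt u i))
    (λ t → true , red⁻ i _ u t) (λ t → false , red⁻ i _ u t)
    (≼-size-antisym (red-∨ i χ) same-size (removeAt u i) (red⁺ i (proj zero χ) u p q))
  where
  same-size : size (proj zero (red (suc i) χ)) ≡ size (red i (proj zero χ))
  same-size = trans (proj₂ (proj₂ (Max-red-proj zero (proj₁ (Max-red-proj (suc i) mx)))))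
                    (sym (proj₂ (proj₁ (Max-red-proj i (proj₂ (Max-red-proj zero mx))))))

Step : ∀ {N} → BClass N → Cube N → Cube N → Set
Step χ u v = χ u ≡ true × χ v ≡ true × ∃[ i ] v ≡ flip i u

Path : ∀ {N} → BClass N → Cube N → Cube N → Set
Path χ = Star (Step χ)

vertical : ∀ {N} (χ : BClass (suc N)) b c u → χ (b ∷ u) ≡ true → χ (c ∷ u) ≡ true → Path χ (b ∷ u) (c ∷ u)
vertical χ true true u p q = ε
vertical χ true false u p q = (p , q , zero , refl) ◅ ε
vertical χ false true u p q = (p , q , zero , refl) ◅ ε
vertical χ false false u p q = ε

path-lifts : ∀ {N e} {χ : BClass (suc N)} → Max e χ → ∀ {u v} → Path (proj zero χ) u v →
  ∀ b c → χ (b ∷ u) ≡ true → χ (c ∷ v) ≡ true → Path χ (b ∷ u) (c ∷ v)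
path-lifts {χ = χ} mx {u} ε b c p q = vertical χ b c u p q
path-lifts {χ = χ} mx {u} ((πu , πw , i , refl) ◅ path) b c p q with edge-lifts mx i u πu πw
... | a , au , aw = vertical χ b a u p au ◅◅ ((au , aw , suc i , refl) ◅ path-lifts mx path a c aw q)

connected : ∀ {N e} {χ : BClass N} → Max e χ → ∀ u v → χ u ≡ true → χ v ≡ true → Path χ u v
connected mx [] [] p q = ε
connected {χ = χ} mx (b ∷ u) (c ∷ v) p q =
  path-lifts mx (connected (proj₂ (Max-red-proj zero mx)) u v (inProj b u p) (inProj c v q)) b c p q
  where
  inProj : ∀ b u → χ (b ∷ u) ≡ true → proj zero χ u ≡ true
  inProj true u p = ∨-true⁺ˡ _ p
  inProj false u p = ∨-true⁺ʳ (χ (true ∷ u)) p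

-- Counting

does⁻ : ∀ {p} {P : Set p} (P? : Dec P) → does P? ≡ true → P
does⁻ (yes p) _ = p

length-filter-map : ∀ {a b p} {A : Set a} {B : Set b} {P : B → Set p} (P? : ∀ y → Dec (P y)) (f : A → B) xs →
  length (filter P? (map f xs)) ≡ length (filter (P? ∘ f) xs)
length-filter-map P? f [] = refl
length-filter-map P? f (x ∷ xs) with P? (f x)
... | yes _ = cong suc (length-filter-map P? f xs)
... | no _ = length-filter-map P? f xs

length-filter-allVecs : ∀ {N p} {P : Cube N → Set p} (P? : ∀ v → Dec (P v)) →
  length (filter P? (allVecs N)) ≡ size (λ v → does (P? v))
length-filter-allVecs {zero} P? with P? []
... | yes _ = refl
... | no _ = refl
length-filter-allVecs {suc N} P? = begin
  length (filter P? (map (true ∷_) (allVecs N) ++ map (false ∷_) (allVecs N)))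
    ≡⟨ cong length (filter-++ P? (map (true ∷_) (allVecs N)) _) ⟩
  length (filter P? (map (true ∷_) (allVecs N)) ++ filter P? (map (false ∷_) (allVecs N)))
    ≡⟨ length-++ (filter P? (map (true ∷_) (allVecs N))) ⟩
  length (filter P? (map (true ∷_) (allVecs N))) + length (filter P? (map (false ∷_) (allVecs N)))
    ≡⟨ cong₂ _+_ (length-filter-map P? (true ∷_) (allVecs N)) (length-filter-map P? (false ∷_) (allVecs N)) ⟩
  length (filter (λ v → P? (true ∷ v)) (allVecs N)) + length (filter (λ v → P? (false ∷ v)) (allVecs N))
    ≡⟨ cong₂ _+_ (length-filter-allVecs (λ v → P? (true ∷ v))) (length-filter-allVecs (λ v → P? (false ∷ v))) ⟩
  size (λ v → does (P? v)) ∎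
  where open ≡-Reasoning

nC0≡1 : ∀ n → n C 0 ≡ 1
nC0≡1 n = trans (nCk≡nC[n∸k] {0} {n} z≤n) (nCn≡1 n)

size-false : ∀ N → size {N} (λ _ → false) ≡ 0
size-false zero = refl
size-false (suc N) = cong₂ _+_ (size-false N) (size-false N)

size-level : ∀ N d → size {N} (λ v → ∣ v ∣ ≡ᵇ d) ≡ N C d
size-level zero zero = refl
size-level zero (suc d) = refl
size-level (suc N) zero =
  trans (cong₂ _+_ (size-false N) (trans (size-level N 0) (nC0≡1 N))) (sym (nC0≡1 (suc N)))
size-level (suc N) (suc d) =
  trans (cong₂ _+_ (size-level N d) (size-level N (suc d))) (nCk+nC[k+1]≡[n+1]C[k+1] N d)

size-ball : ∀ N e → size {N} (λ v → ∣ v ∣ <ᵇ e) ≡ ball N e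
size-ball zero zero = refl
size-ball zero (suc e) = refl
size-ball (suc N) zero = cong₂ _+_ (size-ball N 0) (size-ball N 0)
size-ball (suc N) (suc e) = cong₂ _+_ (size-ball N e) (size-ball N (suc e))

ball-zero : ∀ N → ball N 0 ≡ 0
ball-zero zero = refl
ball-zero (suc N) = cong₂ _+_ (ball-zero N) (ball-zero N)

ball-suc : ∀ N e → ball N (suc e) ≡ ball N e + N C e
ball-suc zero zero = refl
ball-suc zero (suc e) = refl
ball-suc (suc N) zero = begin
  ball N 0 + ball N 1                 ≡⟨ cong (ball N 0 +_) (ball-suc N 0) ⟩
  ball N 0 + (ball N 0 + N C 0)       ≡⟨ sym (+-assoc (ball N 0) (ball N 0) (N C 0)) ⟩
  ball N 0 + ball N 0 + N C 0         ≡⟨ cong (ball N 0 + ball N 0 +_) (trans (nC0≡1 N) (sym (nC0≡1 (suc N)))) ⟩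
  ball N 0 + ball N 0 + suc N C 0     ∎
  where open ≡-Reasoning
ball-suc (suc N) (suc e) = begin
  ball N (suc e) + ball N (suc (suc e))                  ≡⟨ cong₂ _+_ (ball-suc N e) (ball-suc N (suc e)) ⟩
  (ball N e + N C e) + (ball N (suc e) + N C suc e)      ≡⟨ interchange +-commutativeSemigroup (ball N e) _ _ _ ⟩
  (ball N e + ball N (suc e)) + (N C e + N C suc e)      ≡⟨ cong (ball N e + ball N (suc e) +_) (nCk+nC[k+1]≡[n+1]C[k+1] N e) ⟩
  (ball N e + ball N (suc e)) + suc N C suc e            ∎
  where open ≡-Reasoning

sum-upTo-suc : ∀ (f : ℕ → ℕ) n → sum (map f (upTo (suc n))) ≡ sum (map f (upTo n)) + f n
sum-upTo-suc f n = begin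
  sum (map f (upTo (suc n)))                ≡⟨ cong (sum ∘ map f) (sym (upTo-∷ʳ n)) ⟩
  sum (map f (upTo n ++ [ n ]))             ≡⟨ cong sum (map-++ f (upTo n) [ n ]) ⟩
  sum (map f (upTo n) ++ [ f n ])           ≡⟨ sum-++ (map f (upTo n)) [ f n ] ⟩
  sum (map f (upTo n)) + (f n + 0)          ≡⟨ cong (sum (map f (upTo n)) +_) (+-identityʳ (f n)) ⟩
  sum (map f (upTo n)) + f n                ∎
  where open ≡-Reasoning

binomSum≡ball : ∀ N d → binomSum N d ≡ ball N (suc d)
binomSum≡ball N zero =
  trans (sum-upTo-suc (N C_) 0) (sym (trans (ball-suc N 0) (cong (_+ N C 0) (ball-zero N))))
binomSum≡ball N (suc d) =
  trans (sum-upTo-suc (N C_) (suc d)) (trans (cong (_+ N C suc d) (binomSum≡ball N d)) (sym (ball-suc N (suc d))))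

binomSum≡1+binomSum₁ : ∀ N d → binomSum N d ≡ suc (binomSum₁ N d)
binomSum≡1+binomSum₁ N zero = trans (+-identityʳ _) (nC0≡1 N)
binomSum≡1+binomSum₁ N (suc d) =
  trans (sum-upTo-suc (N C_) (suc d))
  (trans (cong (_+ N C suc d) (binomSum≡1+binomSum₁ N d)) (cong suc (sym (sum-upTo-suc (λ i → N C suc i) d))))

module _ {N : ℕ} where
  open DecMembership (_≟ᶜ_ {N}) using (_∈?_)

  members : Class N → BClass N
  members 𝒞 v = does (v ∈? 𝒞)

  members-true⁺ : ∀ {𝒞 v} → v ∈ 𝒞 → members 𝒞 v ≡ true
  members-true⁺ {𝒞} {v} = dec-true (v ∈? 𝒞)

  sh⇒Shatters : ∀ {𝒞} Y → sh Y (members 𝒞) ≡ true → Shatters 𝒞 Y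
  sh⇒Shatters {𝒞} Y s = All.tabulate λ {p} _ →
    let c , χc , agree = sh-sound Y (members 𝒞) s p in lose (does⁻ (c ∈? 𝒞) χc) agree

  size-members : ∀ {𝒞} → 𝒞 ∈ sublists (allVecs N) → size (members 𝒞) ≡ length 𝒞
  size-members {𝒞} 𝒞∈ = trans (sym (length-filter-allVecs (_∈? 𝒞)))
    (cong length (filter-∈-sublist _≟ᶜ_ (allVecs-unique N) 𝒞∈))

  IsMaximum⇒Max : ∀ {d 𝒞} → 𝒞 ∈ sublists (allVecs N) → IsMaximum d 𝒞 → Max (suc d) (members 𝒞)
  IsMaximum⇒Max {d} 𝒞∈ ((_ , vc) , len) =
    (λ Y s → s≤s (All.lookup vc (allVecs-complete Y) (sh⇒Shatters Y s))) ,
    trans (size-members 𝒞∈) (trans len (binomSum≡ball N d))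

  exit : ∀ {χ : BClass N} {u w} (L : List (Cube N)) → Path χ u w → u ∈ L → w ∉ L →
    ∃[ v ] ∃[ i ] v ∈ L × flip i v ∉ L × χ (flip i v) ≡ true
  exit L ε u∈ w∉ = ⊥-elim (w∉ u∈)
  exit {u = u} L ((_ , χv , i , refl) ◅ path) u∈ w∉ with flip i u ∈? L
  ... | yes v∈ = exit L path v∈ w∉
  ... | no v∉ = u , i , u∈ , v∉ , χv

-- Spanning trees and the upper bound

-- Binary encoding of rose trees: node i s t has a child in direction i with subtree s; t holds the remaining children.
data Tree (N : ℕ) : Set where
  leaf : Tree N
  node : Fin N → Tree N → Tree N → Tree N

nodes : ∀ {N} → Tree N → ℕ
nodes leaf = 0
nodes (node _ s t) = suc (nodes s + nodes t)

descendants : ∀ {N} → Cube N → Tree N → List (Cube N)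
descendants r leaf = []
descendants r (node i s t) = flip i r ∷ descendants (flip i r) s ++ descendants r t

length-descendants : ∀ {N} (r : Cube N) t → length (descendants r t) ≡ nodes t
length-descendants r leaf = refl
length-descendants r (node i s t) = cong suc (trans (length-++ (descendants (flip i r) s))
  (cong₂ _+_ (length-descendants (flip i r) s) (length-descendants r t)))

add-leaf : ∀ {N} (r : Cube N) t {v} i → v ∈ r ∷ descendants r t →
  ∃[ t′ ] descendants r t′ ↭ flip i v ∷ descendants r t
add-leaf r t i (here refl) = node i leaf t , ↭-refl
add-leaf r (node j s t) i (there v∈) with ∈-++⁻ (flip j r ∷ descendants (flip j r) s) v∈
... | inj₁ v∈s with add-leaf (flip j r) s i v∈s
... | s′ , p = node j s′ t , ↭-trans (prep _ (++⁺ʳ (descendants r t) p)) (swap _ _ ↭-refl)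
add-leaf r (node j s t) i (there v∈) | inj₂ v∈t with add-leaf r t i (there v∈t)
... | t′ , p = node j s t′ , ↭-trans (++⁺ˡ (flip j r ∷ descendants (flip j r) s) p)
                               (shift _ (flip j r ∷ descendants (flip j r) s) (descendants r t))

module _ {N : ℕ} {𝒞 : Class N} (𝒞! : Unique 𝒞)
  (conn : ∀ u v → members 𝒞 u ≡ true → members 𝒞 v ≡ true → Path (members 𝒞) u v)
  {r : Cube N} (r∈ : r ∈ 𝒞) where
  open DecMembership (_≟ᶜ_ {N}) using (_∈?_)

  partial-spanning-tree : ∀ n → n < length 𝒞 →
    ∃[ t ] nodes t ≡ n × Unique (r ∷ descendants r t) × (r ∷ descendants r t) ⊆ 𝒞
  partial-spanning-tree zero _ = leaf , refl , [] ∷ [] , λ { (here refl) → r∈ }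
  partial-spanning-tree (suc n) lt with partial-spanning-tree n (<-trans (n<1+n n) lt)
  ... | t , refl , u , sub
      with ∃-∉ _≟ᶜ_ 𝒞! (subst (_< length 𝒞) (cong suc (sym (length-descendants r t))) lt)
  ... | w , w∈ , w∉
      with exit (r ∷ descendants r t) (conn r w (members-true⁺ r∈) (members-true⁺ w∈)) (here refl) w∉
  ... | v , i , v∈ , new∉ , χnew with add-leaf r t i v∈
  ... | t′ , p = t′ , trans (sym (length-descendants r t′)) (trans (↭-length p) (cong suc (length-descendants r t))) ,
      SetoidPerm.Unique-resp-↭ (setoid (Cube N)) (↭⇒↭ₛ (↭-sym q)) (All.¬Any⇒All¬ _ new∉ ∷ u) ,
      λ z∈ → lemma (∈-resp-↭ q z∈)
    where
    q : r ∷ descendants r t′ ↭ flip i v ∷ r ∷ descendants r t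
    q = ↭-trans (prep r p) (swap _ _ ↭-refl)
    lemma : ∀ {z} → z ∈ flip i v ∷ r ∷ descendants r t → z ∈ 𝒞
    lemma (here refl) = does⁻ (flip i v ∈? 𝒞) χnew
    lemma (there z∈) = sub z∈

  spanning-tree : ∀ {n} → length 𝒞 ≡ suc n →
    ∃[ t ] nodes t ≡ n × (r ∷ descendants r t) ⊆ 𝒞 × 𝒞 ⊆ (r ∷ descendants r t)
  spanning-tree {n} len with partial-spanning-tree n (≤-reflexive (sym len))
  ... | t , refl , u , sub = t , refl , sub , sup
    where
    sup : 𝒞 ⊆ (r ∷ descendants r t)
    sup {z} z∈ with z ∈? (r ∷ descendants r t)
    ... | yes p = p
    ... | no z∉ = ⊥-elim (1+n≰n (≤-trans
      (unique-⊆-length (All.¬Any⇒All¬ _ z∉ ∷ u) λ { (here refl) → z∈ ; (there y∈) → sub y∈ })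
      (≤-reflexive (trans len (cong suc (sym (length-descendants r t)))))))

-- A depth-first traversal: just i descends in direction i, nothing backtracks.
Walk : ℕ → Set
Walk N = List (Maybe (Fin N))

walks : ∀ N → ℕ → ℕ → List (Walk N)
walks N zero zero = [ [] ]
walks N zero (suc b) = map (nothing ∷_) (walks N zero b)
walks N (suc a) zero = cartesianProductWith (λ i w → just i ∷ w) (allFin N) (walks N a zero)
walks N (suc a) (suc b) =
  cartesianProductWith (λ i w → just i ∷ w) (allFin N) (walks N a (suc b)) ++ map (nothing ∷_) (walks N (suc a) b)

∈-walks-just : ∀ {N} a b i {w : Walk N} → w ∈ walks N a b → just i ∷ w ∈ walks N (suc a) b
∈-walks-just a zero i w∈ = ∈-cartesianProductWith⁺ _ (∈-allFin i) w∈
∈-walks-just a (suc b) i w∈ = ∈-++⁺ˡ (∈-cartesianProductWith⁺ _ (∈-allFin i) w∈)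

∈-walks-nothing : ∀ {N} a b {w : Walk N} → w ∈ walks N a b → nothing ∷ w ∈ walks N a (suc b)
∈-walks-nothing zero b w∈ = ∈-map⁺ _ w∈
∈-walks-nothing {N} (suc a) b w∈ =
  ∈-++⁺ʳ (cartesianProductWith (λ i w → just i ∷ w) (allFin N) (walks N a (suc b))) (∈-map⁺ _ w∈)

length-cartesianProductWith : ∀ {a b c} {A : Set a} {B : Set b} {C : Set c} (f : A → B → C) xs ys →
  length (cartesianProductWith f xs ys) ≡ length xs * length ys
length-cartesianProductWith f [] ys = refl
length-cartesianProductWith f (x ∷ xs) ys = trans (length-++ (map (f x) ys))
  (cong₂ _+_ (length-map (f x) ys) (length-cartesianProductWith f xs ys))

length-walks : ∀ N a b → length (walks N a b) ≤ 2 ^ (a + b) * N ^ a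
length-walks N zero zero = ≤-refl
length-walks N zero (suc b) = begin
  length (map (nothing ∷_) (walks N zero b))  ≡⟨ length-map _ (walks N zero b) ⟩
  length (walks N zero b)                     ≤⟨ length-walks N zero b ⟩
  2 ^ b * 1                                   ≤⟨ *-monoˡ-≤ 1 (m≤m+n (2 ^ b) _) ⟩
  2 ^ suc b * 1                               ∎
  where open ≤-Reasoning
length-walks N (suc a) b = ≤-trans (body b) (≤-reflexive (rearrange (2 ^ (a + b)) (N ^ a)))
  where
  open ≤-Reasoning
  rearrange : ∀ x y → N * (x * y) + N * (x * y) ≡ 2 * x * (N * y)
  rearrange x y = begin-equality
    N * (x * y) + N * (x * y)   ≡⟨ cong (λ z → z + z) (trans (sym (*-assoc N x y)) (trans (cong (_* y) (*-comm N x)) (*-assoc x N y))) ⟩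
    x * (N * y) + x * (N * y)   ≡⟨ sym (*-distribʳ-+ (N * y) x x) ⟩
    (x + x) * (N * y)           ≡⟨ cong (λ z → (x + z) * (N * y)) (sym (+-identityʳ x)) ⟩
    2 * x * (N * y)             ∎
  push : ∀ b → length (cartesianProductWith (λ i w → just i ∷ w) (allFin N) (walks N a b)) ≤ N * (2 ^ (a + b) * N ^ a)
  push b = begin
    length (cartesianProductWith (λ i w → just i ∷ w) (allFin N) (walks N a b))
      ≡⟨ length-cartesianProductWith (λ i w → just i ∷ w) (allFin N) (walks N a b) ⟩
    length (allFin N) * length (walks N a b)
      ≡⟨ cong (_* length (walks N a b)) (length-tabulate {n = N} id) ⟩
    N * length (walks N a b)
      ≤⟨ *-monoʳ-≤ N (length-walks N a b) ⟩
    N * (2 ^ (a + b) * N ^ a) ∎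
  body : ∀ b → length (walks N (suc a) b) ≤ N * (2 ^ (a + b) * N ^ a) + N * (2 ^ (a + b) * N ^ a)
  body zero = ≤-trans (push zero) (m≤m+n _ _)
  body (suc b) = begin
    length (walks N (suc a) (suc b))
      ≡⟨ length-++ (cartesianProductWith (λ i w → just i ∷ w) (allFin N) (walks N a (suc b))) ⟩
    length (cartesianProductWith (λ i w → just i ∷ w) (allFin N) (walks N a (suc b))) + length (map (nothing ∷_) (walks N (suc a) b))
      ≤⟨ +-mono-≤ (push (suc b)) (begin
           length (map (nothing ∷_) (walks N (suc a) b))  ≡⟨ length-map _ (walks N (suc a) b) ⟩
           length (walks N (suc a) b)                     ≤⟨ length-walks N (suc a) b ⟩
           2 ^ (suc a + b) * N ^ suc a                    ≡⟨ cong (λ z → 2 ^ z * N ^ suc a) (sym (+-suc a b)) ⟩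
           2 ^ (a + suc b) * (N * N ^ a)                  ≡⟨ trans (sym (*-assoc (2 ^ (a + suc b)) N _)) (trans (cong (_* N ^ a) (*-comm (2 ^ (a + suc b)) N)) (*-assoc N _ _)) ⟩
           N * (2 ^ (a + suc b) * N ^ a)                  ∎) ⟩
    N * (2 ^ (a + suc b) * N ^ a) + N * (2 ^ (a + suc b) * N ^ a) ∎

traverse : ∀ {N} → Tree N → Walk N → Walk N
traverse leaf w = w
traverse (node i s t) w = just i ∷ traverse s (nothing ∷ traverse t w)

∈-walks-traverse : ∀ {N} t {a b} {w : Walk N} → w ∈ walks N a b → traverse t w ∈ walks N (nodes t + a) (nodes t + b)
∈-walks-traverse leaf w∈ = w∈
∈-walks-traverse {N} (node i s t) {a} {b} {w} w∈ =
  subst₂ (λ x y → just i ∷ traverse s (nothing ∷ traverse t w) ∈ walks N (suc x) y)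
    (sym (+-assoc (nodes s) (nodes t) a))
    (trans (+-suc (nodes s) (nodes t + b)) (cong suc (sym (+-assoc (nodes s) (nodes t) b))))
    (∈-walks-just (nodes s + (nodes t + a)) (nodes s + suc (nodes t + b)) i
      (∈-walks-traverse s {nodes t + a} {suc (nodes t + b)}
        (∈-walks-nothing (nodes t + a) (nodes t + b) (∈-walks-traverse t {a} {b} w∈))))

visited : ∀ {N} → Cube N → List (Cube N) → Walk N → List (Cube N)
visited r stack [] = []
visited r stack (just i ∷ w) = flip i r ∷ visited (flip i r) (r ∷ stack) w
visited r [] (nothing ∷ w) = []
visited r (s ∷ stack) (nothing ∷ w) = visited s stack w

visited-traverse : ∀ {N} (r : Cube N) stack t w → visited r stack (traverse t w) ≡ descendants r t ++ visited r stack w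
visited-traverse r stack leaf w = refl
visited-traverse r stack (node i s t) w = cong (flip i r ∷_) (begin
  visited (flip i r) (r ∷ stack) (traverse s (nothing ∷ traverse t w))
    ≡⟨ visited-traverse (flip i r) (r ∷ stack) s (nothing ∷ traverse t w) ⟩
  descendants (flip i r) s ++ visited r stack (traverse t w)
    ≡⟨ cong (descendants (flip i r) s ++_) (visited-traverse r stack t w) ⟩
  descendants (flip i r) s ++ (descendants r t ++ visited r stack w)
    ≡⟨ sym (++-assoc (descendants (flip i r) s) _ _) ⟩
  (descendants (flip i r) s ++ descendants r t) ++ visited r stack w ∎)
  where open ≡-Reasoning

module _ (N d : ℕ) where
  open DecMembership (_≟ᶜ_ {N}) using (_∈?_)

  K : ℕ
  K = binomSum₁ N d

  decode : Cube N → Walk N → Class N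
  decode r w = filter (_∈? (r ∷ visited r [] w)) (allVecs N)

  maximum-decodes : ∀ {𝒞} → 𝒞 ∈ sublists (allVecs N) → IsMaximum d 𝒞 →
    𝒞 ∈ cartesianProductWith decode (allVecs N) (walks N K K)
  maximum-decodes {[]} 𝒞∈ (_ , len) = ⊥-elim (0≢1+n (trans len (binomSum≡1+binomSum₁ N d)))
  maximum-decodes {𝒞@(r ∷ _)} 𝒞∈ max@(_ , len)
    with spanning-tree {𝒞 = 𝒞} (subst Unique 𝒞-filter (Unique.filter⁺ (_∈? 𝒞) (allVecs-unique N)))
           (connected (IsMaximum⇒Max 𝒞∈ max)) (here refl) (trans len (binomSum≡1+binomSum₁ N d))
    where
    𝒞-filter : filter (_∈? 𝒞) (allVecs N) ≡ 𝒞
    𝒞-filter = filter-∈-sublist _≟ᶜ_ (allVecs-unique N) 𝒞∈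
  ... | t , nodes-t , sub , sup = subst (_∈ _) decode-eq
      (∈-cartesianProductWith⁺ decode (allVecs-complete r) traverse∈)
    where
    traverse∈ : traverse t [] ∈ walks N K K
    traverse∈ = subst (λ n → traverse t [] ∈ walks N n n) (trans (+-identityʳ (nodes t)) nodes-t)
      (∈-walks-traverse t {0} {0} (here refl))
    visited-eq : visited r [] (traverse t []) ≡ descendants r t
    visited-eq = trans (visited-traverse r [] t []) (++-identityʳ _)
    decode-eq : decode r (traverse t []) ≡ 𝒞
    decode-eq = trans
      (filter-cong (_∈? (r ∷ visited r [] (traverse t []))) (_∈? 𝒞) (allVecs N)
        (λ _ p → sub (subst (λ l → _ ∈ r ∷ l) visited-eq p))
        (λ _ p → subst (λ l → _ ∈ r ∷ l) (sym visited-eq) (sup p)))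
      (filter-∈-sublist _≟ᶜ_ (allVecs-unique N) 𝒞∈)

  m-upper : m N d ≤ 2 ^ N * (2 ^ (K + K) * N ^ K)
  m-upper = begin
    m N d
      ≤⟨ unique-⊆-length (Unique.filter⁺ (isMaximum? d) (sublists-unique (allVecs-unique N)))
           (λ 𝒞∈ → let p , q = ∈-filter⁻ (isMaximum? d) {xs = sublists (allVecs N)} 𝒞∈ in maximum-decodes p q) ⟩
    length (cartesianProductWith decode (allVecs N) (walks N K K))
      ≡⟨ length-cartesianProductWith decode (allVecs N) (walks N K K) ⟩
    length (allVecs N) * length (walks N K K)
      ≤⟨ *-mono-≤ (≤-reflexive (length-allVecs N)) (length-walks N K K) ⟩
    2 ^ N * (2 ^ (K + K) * N ^ K) ∎
    where open ≤-Reasoning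

-- Pushing d-subsets out of the Hamming ball: the lower bound

unique-map : ∀ {a b r} {A : Set a} {B : Set b} {R : A → A → Set r} (f : A → B) {xs} →
  (∀ {x y} → x ∈ xs → y ∈ xs → R x y → f x ≢ f y) → AllPairs R xs → Unique (map f xs)
unique-map f sep [] = []
unique-map f sep (rs ∷ ap) =
  All.map⁺ (All.tabulate λ y∈ → sep (here refl) (there y∈) (All.lookup rs y∈)) ∷
  unique-map f (λ x∈ y∈ → sep (there x∈) (there y∈)) ap

module _ {a b} {A : Set a} {B : Set b} (_≟_ : DecidableEquality A) where

  override : A → B → (A → B) → A → B
  override x y g z = if does (z ≟ x) then y else g z

  override-same : ∀ x y g → override x y g x ≡ y
  override-same x y g with x ≟ x
  ... | yes _ = refl
  ... | no x≢x = ⊥-elim (x≢x refl)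

  override-other : ∀ {x y} g {z} → z ≢ x → override x y g z ≡ g z
  override-other {x} g {z} z≢x with z ≟ x
  ... | yes z≡x = ⊥-elim (z≢x z≡x)
  ... | no _ = refl

  choice-functions : ∀ {g} {G : A → B → Set g} (f₀ : A → B) q {D} → Unique D →
    All (λ x → ∃[ T ] length T ≡ q × Unique T × All (G x) T) D →
    ∃[ Fs ] length Fs ≡ q ^ length D
      × AllPairs (λ f h → ∃[ x ] x ∈ D × f x ≢ h x) Fs
      × (∀ {f} → f ∈ Fs → (∀ {x} → x ∉ D → f x ≡ f₀ x) × (∀ {x} → x ∈ D → G x (f x)))
  choice-functions f₀ q [] [] = [ f₀ ] , refl , [] ∷ [] , λ { (here refl) → (λ _ → refl) , λ () }
  choice-functions {G = G} f₀ q {x ∷ D} (x∉ ∷ u) ((T , lenT , uT , GT) ∷ ts) with choice-functions f₀ q u ts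
  ... | Fs , lenFs , ap , spec =
    cartesianProductWith (override x) T Fs ,
    trans (length-cartesianProductWith (override x) T Fs) (cong₂ _*_ lenT lenFs) ,
    separated uT ,
    spec′
    where
    ∈⇒≢ : ∀ {z} → z ∈ D → z ≢ x
    ∈⇒≢ z∈ refl = All.lookup x∉ z∈ refl

    separated : ∀ {T} → Unique T →
      AllPairs (λ f h → ∃[ z ] z ∈ x ∷ D × f z ≢ h z) (cartesianProductWith (override x) T Fs)
    separated [] = []
    separated {t ∷ T} (t∉ ∷ uT) = AllPairs.++⁺
      (AllPairs.map⁺ (AllPairs.map (λ {f} {h} (z , z∈ , neq) → z , there z∈ , λ eq →
        neq (trans (sym (override-other f (∈⇒≢ z∈))) (trans eq (override-other h (∈⇒≢ z∈))))) ap))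
      (separated uT)
      (All.tabulate λ f∈ → All.tabulate λ h∈ → cross f∈ h∈)
      where
      cross : ∀ {f h} → f ∈ map (override x t) Fs → h ∈ cartesianProductWith (override x) T Fs →
        ∃[ z ] z ∈ x ∷ D × f z ≢ h z
      cross f∈ h∈ with ∈-map⁻ (override x t) f∈ | ∈-cartesianProductWith⁻ (override x) T Fs h∈
      ... | f , _ , refl | t′ , h , t′∈ , _ , refl = x , here refl , λ eq →
        All.lookup t∉ t′∈ (trans (sym (override-same x t f)) (trans eq (override-same x t′ h)))

    spec′ : ∀ {f} → f ∈ cartesianProductWith (override x) T Fs →
      (∀ {z} → z ∉ x ∷ D → f z ≡ f₀ z) × (∀ {z} → z ∈ x ∷ D → G z (f z))
    spec′ f∈ with ∈-cartesianProductWith⁻ (override x) T Fs f∈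
    ... | t , f , t∈ , f∈Fs , refl =
      (λ z∉ → trans (override-other f (z∉ ∘ here)) (proj₁ (spec f∈Fs) (z∉ ∘ there))) ,
      λ { (here refl) → subst (G _) (sym (override-same x t f)) (All.lookup GT t∈)
        ; (there z∈) → subst (G _) (sym (override-other f (∈⇒≢ z∈))) (proj₂ (spec f∈Fs) z∈) }

infix 4 _⊑_
_⊑_ : ∀ {N} → Subset N → Subset N → Set
u ⊑ v = ∀ i → lookup u i ≡ true → lookup v i ≡ true

⊑⇒∣∣≤ : ∀ {N} {u v : Subset N} → u ⊑ v → ∣ u ∣ ≤ ∣ v ∣
⊑⇒∣∣≤ {u = []} {[]} _ = z≤n
⊑⇒∣∣≤ {u = true ∷ u} {true ∷ v} le = s≤s (⊑⇒∣∣≤ {u = u} {v} (le ∘ suc))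
⊑⇒∣∣≤ {u = true ∷ u} {false ∷ v} le with le zero refl
... | ()
⊑⇒∣∣≤ {u = false ∷ u} {true ∷ v} le = m≤n⇒m≤1+n (⊑⇒∣∣≤ {u = u} {v} (le ∘ suc))
⊑⇒∣∣≤ {u = false ∷ u} {false ∷ v} le = ⊑⇒∣∣≤ {u = u} {v} (le ∘ suc)

⊑-∣∣-antisym : ∀ {N} {u v : Subset N} → u ⊑ v → ∣ v ∣ ≤ ∣ u ∣ → u ≡ v
⊑-∣∣-antisym {u = []} {[]} _ _ = refl
⊑-∣∣-antisym {u = true ∷ u} {true ∷ v} le (s≤s ge) = cong (true ∷_) (⊑-∣∣-antisym {u = u} {v} (le ∘ suc) ge)
⊑-∣∣-antisym {u = true ∷ u} {false ∷ v} le _ with le zero refl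
... | ()
⊑-∣∣-antisym {u = false ∷ u} {true ∷ v} le ge = ⊥-elim (1+n≰n (≤-trans ge (⊑⇒∣∣≤ {u = u} {v} (le ∘ suc))))
⊑-∣∣-antisym {u = false ∷ u} {false ∷ v} le ge = cong (false ∷_) (⊑-∣∣-antisym {u = u} {v} (le ∘ suc) ge)

⊑-remove-one : ∀ {N} {u S : Subset N} → u ⊑ S → ∣ S ∣ ≡ suc ∣ u ∣ →
  ∃[ a ] lookup S a ≡ true × u ≡ S [ a ]≔ false
⊑-remove-one {u = []} {[]} _ ()
⊑-remove-one {u = true ∷ u} {true ∷ S} le eq with ⊑-remove-one {u = u} {S} (le ∘ suc) (suc-injective eq)
... | a , a∈ , refl = suc a , a∈ , refl
⊑-remove-one {u = true ∷ u} {false ∷ S} le eq with le zero refl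
... | ()
⊑-remove-one {u = false ∷ u} {true ∷ S} le eq =
  zero , refl , cong (false ∷_) (⊑-∣∣-antisym {u = u} {S} (le ∘ suc) (≤-reflexive (suc-injective eq)))
⊑-remove-one {u = false ∷ u} {false ∷ S} le eq with ⊑-remove-one {u = u} {S} (le ∘ suc) eq
... | a , a∈ , refl = suc a , a∈ , refl

∣∣-insert : ∀ {N} (A : Subset N) x → lookup A x ≡ false → ∣ A [ x ]≔ true ∣ ≡ suc ∣ A ∣
∣∣-insert (false ∷ A) zero _ = refl
∣∣-insert (true ∷ A) (suc x) x∉ = cong suc (∣∣-insert A x x∉)
∣∣-insert (false ∷ A) (suc x) x∉ = ∣∣-insert A x x∉

insert-remove : ∀ {N} (A : Subset N) x → lookup A x ≡ false → (A [ x ]≔ true) [ x ]≔ false ≡ A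
insert-remove (false ∷ A) zero _ = refl
insert-remove (b ∷ A) (suc x) x∉ = cong (b ∷_) (insert-remove A x x∉)

⊑-insert : ∀ {N} (A : Subset N) x → A ⊑ A [ x ]≔ true
⊑-insert (_ ∷ A) zero zero _ = refl
⊑-insert (_ ∷ A) zero (suc i) e = e
⊑-insert (_ ∷ A) (suc x) zero e = e
⊑-insert (_ ∷ A) (suc x) (suc i) e = ⊑-insert A x i e

weight : ∀ {N} → (Fin N → ℕ) → Subset N → ℕ
weight w [] = 0
weight w (true ∷ v) = w zero + weight (w ∘ suc) v
weight w (false ∷ v) = weight (w ∘ suc) v

weight-remove : ∀ {N} (w : Fin N → ℕ) S a → lookup S a ≡ true → weight w S ≡ weight w (S [ a ]≔ false) + w a
weight-remove w (true ∷ S) zero _ = +-comm (w zero) _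
weight-remove w (true ∷ S) (suc a) a∈ =
  trans (cong (w zero +_) (weight-remove (w ∘ suc) S a a∈)) (sym (+-assoc (w zero) _ _))
weight-remove w (false ∷ S) (suc a) a∈ = weight-remove (w ∘ suc) S a a∈

values : ∀ {N} → (Fin N → ℕ) → Subset N → List ℕ
values w [] = []
values w (true ∷ v) = w zero ∷ values (w ∘ suc) v
values w (false ∷ v) = values (w ∘ suc) v

length-values : ∀ {N} (w : Fin N → ℕ) v → length (values w v) ≡ ∣ v ∣
length-values w [] = refl
length-values w (true ∷ v) = cong suc (length-values (w ∘ suc) v)
length-values w (false ∷ v) = length-values (w ∘ suc) v

∈-values : ∀ {N} (w : Fin N → ℕ) v a → lookup v a ≡ true → w a ∈ values w v
∈-values w (true ∷ v) zero _ = here refl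
∈-values w (true ∷ v) (suc a) a∈ = there (∈-values (w ∘ suc) v a a∈)
∈-values w (false ∷ v) (suc a) a∈ = ∈-values (w ∘ suc) v a a∈

avoided-value : ∀ {N} (w : Fin N → ℕ) v → ∃[ c ] c ≤ ∣ v ∣ × (∀ a → lookup v a ≡ true → w a ≢ c)
avoided-value w v with ∃-∉ _≟_ {upTo (suc ∣ v ∣)} {values w v} (Unique.upTo⁺ (suc ∣ v ∣))
                         (≤-reflexive (trans (cong suc (length-values w v)) (sym (length-upTo (suc ∣ v ∣)))))
... | c , c∈ , c∉ = c , ≤-pred (∈-upTo⁻ c∈) , λ { a a∈ refl → c∉ (∈-values w v a a∈) }

%-cancel : ∀ {p p′ a x} n .{{_ : NonZero n}} → p % n ≡ p′ % n → p + a ≡ p′ + x → a % n ≡ x % n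
%-cancel {p} {p′} {a} {x} n r≡r′ eq = begin
  a % n                       ≡⟨ sym ([m+kn]%n≡m%n a (p / n) n) ⟩
  (a + p / n * n) % n         ≡⟨ cong (_% n) (+-cancelˡ-≡ (p % n) _ _ shifted) ⟩
  (x + p′ / n * n) % n        ≡⟨ [m+kn]%n≡m%n x (p′ / n) n ⟩
  x % n                       ∎
  where
  open ≡-Reasoning
  regroup : ∀ p a → p % n + (a + p / n * n) ≡ p + a
  regroup p a = trans (cong (p % n +_) (+-comm a _))
    (trans (sym (+-assoc (p % n) _ a)) (cong (_+ a) (sym (m≡m%n+[m/n]*n p n))))
  shifted : p % n + (a + p / n * n) ≡ p % n + (x + p′ / n * n)
  shifted = trans (regroup p a) (trans eq (trans (sym (regroup p′ x)) (cong (_+ (x + p′ / n * n)) (sym r≡r′))))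

Good : ∀ {N} → ℕ → List (Subset N) → Subset N → Subset N → Set
Good d D A S = ∣ S ∣ ≡ suc d × A ⊑ S × (∀ {u} → u ∈ D → u ⊑ S → u ≡ A)

-- The members of D have the same sum modulo suc d, so u = (A ∪ {x}) ∖ {a} ∈ D forces x ≡ a.
-- Since A occupies at most d residues, some residue class of x avoids this.
good-supersets : ∀ {N} d r {D : List (Subset N)} →
  (∀ {u} → u ∈ D → ∣ u ∣ ≡ d × weight toℕ u % suc d ≡ r) →
  ∀ {A} → A ∈ D → ∃[ T ] length T ≡ N / suc d × Unique T × All (Good d D A) T
good-supersets {N} d r {D} inD {A} A∈ with avoided-value (λ i → toℕ i % suc d) A
... | c , c≤ , avoids =
  tabulate target , length-tabulate target , Unique.tabulate⁺ target-injective , All.tabulate⁺ good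
  where
  n q : ℕ
  n = suc d
  q = N / n

  ∣A∣≡d : ∣ A ∣ ≡ d
  ∣A∣≡d = proj₁ (inD A∈)

  c<n : c < n
  c<n = s≤s (subst (c ≤_) ∣A∣≡d c≤)

  bound : ∀ (j : Fin q) → c + toℕ j * n < N
  bound j = begin-strict
    c + toℕ j * n    <⟨ +-monoˡ-< (toℕ j * n) c<n ⟩
    suc (toℕ j) * n  ≤⟨ *-monoˡ-≤ n (toℕ<n j) ⟩
    q * n            ≤⟨ m/n*n≤m N n ⟩
    N                ∎
    where open ≤-Reasoning

  x : Fin q → Fin N
  x j = fromℕ< (bound j)

  x%n : ∀ j → toℕ (x j) % n ≡ c
  x%n j = trans (cong (_% n) (toℕ-fromℕ< (bound j))) (trans ([m+kn]%n≡m%n c (toℕ j) n) (m<n⇒m%n≡m c<n))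

  x∉A : ∀ j → lookup A (x j) ≡ false
  x∉A j = ¬-not λ x∈ → avoids (x j) x∈ (x%n j)

  target : Fin q → Subset N
  target j = A [ x j ]≔ true

  target-injective : ∀ {i j} → target i ≡ target j → i ≡ j
  target-injective {i} {j} eq with x i Fin.≟ x j
  ... | yes xi≡xj = toℕ-injective (*-cancelʳ-≡ (toℕ i) (toℕ j) n (+-cancelˡ-≡ c _ _
          (trans (sym (toℕ-fromℕ< (bound i))) (trans (cong toℕ xi≡xj) (toℕ-fromℕ< (bound j))))))
  ... | no xi≢xj with trans (sym (lookup∘update (x i) A true))
                       (trans (cong (λ S → lookup S (x i)) eq) (trans (lookup∘update′ xi≢xj A true) (x∉A i)))
  ... | ()

  good : ∀ j → Good d D A (target j)
  good j = trans (∣∣-insert A (x j) (x∉A j)) (cong suc ∣A∣≡d) , ⊑-insert A (x j) , only-A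
    where
    only-A : ∀ {u} → u ∈ D → u ⊑ target j → u ≡ A
    only-A {u} u∈ u⊑ with ⊑-remove-one {u = u} {target j} u⊑ (trans (∣∣-insert A (x j) (x∉A j)) (cong suc (trans ∣A∣≡d (sym (proj₁ (inD u∈))))))
    ... | a , a∈ , refl with a Fin.≟ x j
    ... | yes refl = insert-remove A (x j) (x∉A j)
    ... | no a≢x = ⊥-elim (avoids a (trans (sym (lookup∘update′ a≢x A true)) a∈) (trans a%n≡x%n (x%n j)))
      where
      weights : weight toℕ u + toℕ a ≡ weight toℕ A + toℕ (x j)
      weights = trans (sym (weight-remove toℕ (target j) a a∈))
        (trans (weight-remove toℕ (target j) (x j) (lookup∘update (x j) A true))
               (cong (λ S → weight toℕ S + toℕ (x j)) (insert-remove A (x j) (x∉A j))))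
      a%n≡x%n : toℕ a % n ≡ toℕ (x j) % n
      a%n≡x%n = %-cancel {weight toℕ u} {weight toℕ A} n (trans (proj₂ (inD u∈)) (sym (proj₂ (inD A∈)))) weights

nCk>0 : ∀ {n k} → k ≤ n → 0 < n C k
nCk>0 {n} {zero} _ = ≤-reflexive (sym (nC0≡1 n))
nCk>0 {suc n} {suc k} (s≤s k≤n) =
  subst (0 <_) (nCk+nC[k+1]≡[n+1]C[k+1] n k) (≤-trans (nCk>0 k≤n) (m≤m+n _ _))

module _ {N d : ℕ} (D : List (Subset N)) (D-level : ∀ {u} → u ∈ D → ∣ u ∣ ≡ d) where
  open DecMembership (_≟ᶜ_ {N}) using (_∈?_)

  Admissible : (Cube N → Cube N) → Set
  Admissible g = (∀ {v} → v ∉ D → g v ≡ v) × (∀ {v} → v ∈ D → Good d D v (g v))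

  lowSets : List (Cube N)
  lowSets = filter (λ v → ∣ v ∣ <? suc d) (allVecs N)

  pushed : (Cube N → Cube N) → Class N
  pushed g = filter (_∈? map g lowSets) (allVecs N)

  ∈-pushed⁺ : ∀ g {v} → ∣ v ∣ ≤ d → g v ∈ pushed g
  ∈-pushed⁺ g {v} le = ∈-filter⁺ (_∈? map g lowSets) (allVecs-complete (g v))
    (∈-map⁺ g (∈-filter⁺ (λ v → ∣ v ∣ <? suc d) (allVecs-complete v) (s≤s le)))

  ∈-pushed⁻ : ∀ g {c} → c ∈ pushed g → ∃[ v ] ∣ v ∣ ≤ d × c ≡ g v
  ∈-pushed⁻ g c∈ with ∈-map⁻ g (proj₂ (∈-filter⁻ (_∈? map g lowSets) {xs = allVecs N} c∈))
  ... | v , v∈ , eq = v , ≤-pred (proj₂ (∈-filter⁻ (λ v → ∣ v ∣ <? suc d) {xs = allVecs N} v∈)) , eq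

  module _ {g h} (g-adm : Admissible g) (h-adm : Admissible h) where

    same-source : ∀ {u v} → u ∈ D → ∣ v ∣ ≤ d → g u ≡ h v → u ≡ v
    same-source {u} {v} u∈ v≤ eq with v ∈? D
    ... | yes v∈ = proj₂ (proj₂ (proj₂ h-adm v∈)) u∈
                     (subst (u ⊑_) eq (proj₁ (proj₂ (proj₂ g-adm u∈))))
    ... | no v∉ = ⊥-elim (1+n≰n (subst (_≤ d)
                     (trans (cong ∣_∣ (sym (trans eq (proj₁ h-adm v∉)))) (proj₁ (proj₂ g-adm u∈))) v≤))

    pushed-determines : pushed g ≡ pushed h → ∀ {u} → u ∈ D → g u ≡ h u
    pushed-determines eq {u} u∈
      with ∈-pushed⁻ h (subst (g u ∈_) eq (∈-pushed⁺ g (≤-reflexive (D-level u∈))))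
    ... | v , v≤ , gu≡hv = trans gu≡hv (cong h (sym (same-source u∈ v≤ gu≡hv)))

  module _ {g} (adm : Admissible g) where

    g-injective : ∀ {u v} → ∣ u ∣ ≤ d → ∣ v ∣ ≤ d → g u ≡ g v → u ≡ v
    g-injective {u} {v} u≤ v≤ eq with u ∈? D | v ∈? D
    ... | yes u∈ | _ = same-source adm adm u∈ v≤ eq
    ... | no _ | yes v∈ = sym (same-source adm adm v∈ u≤ (sym eq))
    ... | no u∉ | no v∉ = trans (sym (proj₁ adm u∉)) (trans eq (proj₁ adm v∉))

    length-pushed : length (pushed g) ≡ ball N (suc d)
    length-pushed = trans (≤-antisym
      (unique-⊆-length (Unique.filter⁺ (_∈? map g lowSets) (allVecs-unique N))
        (λ c∈ → proj₂ (∈-filter⁻ (_∈? map g lowSets) {xs = allVecs N} c∈)))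
      (unique-⊆-length
        (unique-map g (λ u∈ v∈ u≢v eq → u≢v (g-injective (low u∈) (low v∈) eq))
          (Unique.filter⁺ (λ v → ∣ v ∣ <? suc d) (allVecs-unique N)))
        (λ c∈ → ∈-filter⁺ (_∈? map g lowSets) (allVecs-complete _) c∈)))
      (trans (length-map g lowSets)
        (trans (length-filter-allVecs {N} (λ v → ∣ v ∣ <? suc d)) (size-ball N (suc d))))
      where
      low : ∀ {v} → v ∈ lowSets → ∣ v ∣ ≤ d
      low v∈ = ≤-pred (proj₂ (∈-filter⁻ (λ v → ∣ v ∣ <? suc d) {xs = allVecs N} v∈))

    ∣g∣≤ : ∀ {v} → ∣ v ∣ ≤ d → ∣ g v ∣ ≤ suc d
    ∣g∣≤ {v} v≤ with v ∈? D
    ... | yes v∈ = ≤-reflexive (proj₁ (proj₂ adm v∈))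
    ... | no v∉ = m≤n⇒m≤1+n (subst (λ c → ∣ c ∣ ≤ d) (sym (proj₁ adm v∉)) v≤)

    realised : ∀ Y → Shatters (pushed g) Y → ∀ p → ∃[ v ] ∣ v ∣ ≤ d × AgreeOn Y (g v) p
    realised Y sh p with find (All.lookup sh (allVecs-complete p))
    ... | c , c∈ , agree with ∈-pushed⁻ g c∈
    ... | v , v≤ , refl = v , v≤ , agree

    -- If |Y| > d, the full pattern on Y forces Y = g v with v ∈ D, and then the pattern v on Y is missing.
    pushed-VC : ∀ Y → Shatters (pushed g) Y → ∣ Y ∣ ≤ d
    pushed-VC Y sh with ∣ Y ∣ ≤? d
    ... | yes Y≤ = Y≤
    ... | no Y≰ with realised Y sh Y
    ... | v , v≤ , agree = ⊥-elim (absurd (v ∈? D))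
      where
      Y⊑gv : Y ⊑ g v
      Y⊑gv i i∈Y = trans (agree i i∈Y) i∈Y

      Y≡gv : Y ≡ g v
      Y≡gv = ⊑-∣∣-antisym {u = Y} {g v} Y⊑gv (≤-trans (∣g∣≤ v≤) (≰⇒> Y≰))

      absurd : ¬ Dec (v ∈ D)
      absurd (no v∉) = Y≰ (subst (λ c → ∣ c ∣ ≤ d) (sym (trans Y≡gv (proj₁ adm v∉))) v≤)
      absurd (yes v∈) with realised Y sh v
      ... | u , u≤ , agree′ = Y≰ (≤-trans (⊑⇒∣∣≤ {u = Y} {v} Y⊑v) v≤)
        where
        v⊑Y : v ⊑ Y
        v⊑Y = subst (v ⊑_) (sym Y≡gv) (proj₁ (proj₂ (proj₂ adm v∈)))
        v⊑gu : v ⊑ g u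
        v⊑gu i i∈v = trans (agree′ i (v⊑Y i i∈v)) i∈v
        v≡u : v ≡ u
        v≡u with u ∈? D
        ... | yes u∈ = proj₂ (proj₂ (proj₂ adm u∈)) v∈ v⊑gu
        ... | no u∉ = ⊑-∣∣-antisym {u = v} {u} (subst (v ⊑_) (proj₁ adm u∉) v⊑gu)
                        (subst (∣ u ∣ ≤_) (sym (D-level v∈)) u≤)
        Y⊑v : Y ⊑ v
        Y⊑v i i∈Y = trans (sym (agree′ i i∈Y)) (Y⊑gu i i∈Y)
          where
          Y⊑gu : Y ⊑ g u
          Y⊑gu = subst (λ c → Y ⊑ g c) v≡u Y⊑gv

    -- By Sauer–Shelah, a class of this size cannot have VC dimension below d.
    pushed-maximum : d ≤ N → IsMaximum d (pushed g)
    pushed-maximum d≤N = (shattered , All.tabulate (λ {Y} _ → pushed-VC Y)) , trans length-pushed (sym (binomSum≡ball N d))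
      where
      shattered : Any (λ Y → ∣ Y ∣ ≡ d × Shatters (pushed g) Y) (allVecs N)
      shattered with Any.any? (λ Y → (∣ Y ∣ ≟ d) ×-dec shatters? (pushed g) Y) (allVecs N)
      ... | yes p = p
      ... | no ¬p = ⊥-elim (<⇒≱ (nCk>0 d≤N) (+-cancelˡ-≤ (ball N d) _ _ (begin
          ball N d + N C d            ≡⟨ sym (ball-suc N d) ⟩
          ball N (suc d)              ≡⟨ sym length-pushed ⟩
          length (pushed g)           ≡⟨ sym (size-members (filter∈sublists (_∈? map g lowSets) (allVecs N))) ⟩
          size (members (pushed g))   ≤⟨ sauer d _ vc ⟩
          ball N d                    ≡⟨ sym (+-identityʳ _) ⟩
          ball N d + 0                ∎)))
        where
        open ≤-Reasoning
        vc : VC< d (members (pushed g))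
        vc Y s = ≤∧≢⇒< (pushed-VC Y Y-sh) λ eq → ¬p (lose (allVecs-complete Y) (eq , Y-sh))
          where
          Y-sh : Shatters (pushed g) Y
          Y-sh = sh⇒Shatters Y s

module _ {N d : ℕ} (d≤N : d ≤ N) where

  level : List (Subset N)
  level = filter (λ v → ∣ v ∣ ≟ d) (allVecs N)

  colour : Subset N → ℕ
  colour v = weight toℕ v % suc d

  colourClass : ℕ → List (Subset N)
  colourClass r = filter (λ v → colour v ≟ r) level

  level-unique : Unique level
  level-unique = Unique.filter⁺ (λ v → ∣ v ∣ ≟ d) (allVecs-unique N)

  ∈-colourClass⁻ : ∀ {r v} → v ∈ colourClass r → ∣ v ∣ ≡ d × colour v ≡ r
  ∈-colourClass⁻ {r} v∈ with ∈-filter⁻ (λ v → colour v ≟ r) {xs = level} v∈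
  ... | v∈level , eq = proj₂ (∈-filter⁻ (λ v → ∣ v ∣ ≟ d) {xs = allVecs N} v∈level) , eq

  colourClass-bound : ∀ r → (N / suc d) ^ length (colourClass r) ≤ m N d
  colourClass-bound r
    with choice-functions _≟ᶜ_ {G = Good d (colourClass r)} id (N / suc d)
           (Unique.filter⁺ (λ v → colour v ≟ r) level-unique)
           (All.tabulate (good-supersets d r ∈-colourClass⁻))
  ... | Fs , len , sep , adm = begin
    (N / suc d) ^ length (colourClass r)          ≡⟨ sym len ⟩
    length Fs                                     ≡⟨ sym (length-map cls Fs) ⟩
    length (map cls Fs)                           ≤⟨ unique-⊆-length
      (unique-map cls (λ f∈ h∈ (u , u∈ , neq) eq →
        neq (pushed-determines (colourClass r) onLevel (adm f∈) (adm h∈) eq u∈)) sep) included ⟩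
    m N d                                         ∎
    where
    open ≤-Reasoning
    open DecMembership (_≟ᶜ_ {N}) using (_∈?_)
    onLevel : ∀ {u} → u ∈ colourClass r → ∣ u ∣ ≡ d
    onLevel = proj₁ ∘ ∈-colourClass⁻
    cls : (Cube N → Cube N) → Class N
    cls = pushed (colourClass r) onLevel
    included : map cls Fs ⊆ filter (isMaximum? d) (sublists (allVecs N))
    included c∈ with ∈-map⁻ cls c∈
    ... | f , f∈ , refl = ∈-filter⁺ (isMaximum? d)
      (filter∈sublists (_∈? _) (allVecs N)) (pushed-maximum (colourClass r) onLevel (adm f∈) d≤N)

  m-lower : .{{_ : NonZero (N / suc d)}} → (N / suc d) ^ (N C d) ≤ m N d ^ suc d
  m-lower = subst (λ n → q ^ n ≤ m N d ^ suc d)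
    (trans (cong length (filter-all (λ v → colour v <? suc d) {level} (All.tabulate λ {v} _ → m%n<n (weight toℕ v) (suc d))))
           (trans (length-filter-allVecs {N} (λ v → ∣ v ∣ ≟ d)) (size-level N d)))
    (go (suc d))
    where
    q : ℕ
    q = N / suc d
    below : ℕ → List (Subset N)
    below r = filter (λ v → colour v <? r) level
    split : ∀ r → length (below (suc r)) ≤ length (below r) + length (colourClass r)
    split r = subst (length (below (suc r)) ≤_) (length-++ (below r))
      (unique-⊆-length (Unique.filter⁺ (λ v → colour v <? suc r) level-unique) sub)
      where
      sub : below (suc r) ⊆ below r ++ colourClass r
      sub v∈ with ∈-filter⁻ (λ v → colour v <? suc r) {xs = level} v∈
      ... | v∈level , lt with m<1+n⇒m<n∨m≡n lt
      ... | inj₁ lt′ = ∈-++⁺ˡ (∈-filter⁺ (λ v → colour v <? r) v∈level lt′)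
      ... | inj₂ eq = ∈-++⁺ʳ (below r) (∈-filter⁺ (λ v → colour v ≟ r) v∈level eq)
    go : ∀ r → q ^ length (below r) ≤ m N d ^ r
    go zero = ≤-reflexive (cong (λ L → q ^ length L)
      (filter-none (λ v → colour v <? 0) {level} (All.tabulate λ _ ())))
    go (suc r) = begin
      q ^ length (below (suc r))                              ≤⟨ ^-monoʳ-≤ q (split r) ⟩
      q ^ (length (below r) + length (colourClass r))         ≡⟨ ^-distribˡ-+-* q (length (below r)) _ ⟩
      q ^ length (below r) * q ^ length (colourClass r)       ≤⟨ *-mono-≤ (go r) (colourClass-bound r) ⟩
      m N d ^ r * m N d                                       ≡⟨ *-comm (m N d ^ r) _ ⟩
      m N d ^ suc r                                           ∎
      where open ≤-Reasoning

^-distribʳ-* : ∀ k x y → (x * y) ^ k ≡ x ^ k * y ^ k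
^-distribʳ-* zero x y = refl
^-distribʳ-* (suc k) x y = begin
  x * y * (x * y) ^ k         ≡⟨ cong (x * y *_) (^-distribʳ-* k x y) ⟩
  x * y * (x ^ k * y ^ k)     ≡⟨ [m*n]*[o*p]≡[m*o]*[n*p] x y (x ^ k) (y ^ k) ⟩
  x * x ^ k * (y * y ^ k)     ∎
  where open ≡-Reasoning

^-exchange : ∀ x a b → (x ^ a) ^ b ≡ (x ^ b) ^ a
^-exchange x a b = trans (^-*-assoc x a b) (trans (cong (x ^_) (*-comm a b)) (sym (^-*-assoc x b a)))

lower-exponent : ∀ n .{{_ : NonZero n}} k N → (2 * n) ^ suc k ≤ N / n → 0 < N / n → N ^ k ≤ (N / n) ^ suc k
lower-exponent n k N Q≤q 0<q = begin
  N ^ k                    ≤⟨ ^-monoˡ-≤ k N≤ ⟩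
  (2 * n * q) ^ k          ≡⟨ ^-distribʳ-* k (2 * n) q ⟩
  (2 * n) ^ k * q ^ k      ≤⟨ *-monoˡ-≤ (q ^ k) (≤-trans (^-monoʳ-≤ (2 * n) {{m*n≢0 2 n}} (n≤1+n k)) Q≤q) ⟩
  q * q ^ k                ∎
  where
  open ≤-Reasoning
  q : ℕ
  q = N / n
  N≤ : N ≤ 2 * n * q
  N≤ = begin
    N                 ≡⟨ m≡m%n+[m/n]*n N n ⟩
    N % n + q * n     ≤⟨ +-monoˡ-≤ (q * n) (<⇒≤ (m%n<n N n)) ⟩
    n + q * n         ≤⟨ +-monoˡ-≤ (q * n) (m≤n*m n q {{>-nonZero 0<q}}) ⟩
    q * n + q * n     ≡⟨ cong (λ z → z + z) (*-comm q n) ⟩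
    n * q + n * q     ≡⟨ sym (*-distribʳ-+ q n n) ⟩
    (n + n) * q       ≡⟨ cong (λ z → (n + z) * q) (sym (+-identityʳ n)) ⟩
    2 * n * q         ∎

N≤binomSum₁ : ∀ N {d} → 0 < d → N ≤ binomSum₁ N d
N≤binomSum₁ N {suc d} _ = subst (_≤ binomSum₁ N (suc d)) (nC1≡n N) (m≤m+n (N C 1) _)

upper-exponent : ∀ N k {M K} → N ≤ K → 8 ^ k ≤ N → M ≤ 2 ^ N * (2 ^ (K + K) * N ^ K) → M ^ k ≤ N ^ (suc k * K)
upper-exponent N k {M} {K} N≤K 8^k≤N M≤ = begin
  M ^ k                       ≤⟨ ^-monoˡ-≤ k M≤[8N]^K ⟩
  ((8 * N) ^ K) ^ k           ≡⟨ ^-exchange (8 * N) K k ⟩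
  ((8 * N) ^ k) ^ K           ≡⟨ cong (_^ K) (^-distribʳ-* k 8 N) ⟩
  (8 ^ k * N ^ k) ^ K         ≤⟨ ^-monoˡ-≤ K (*-monoˡ-≤ (N ^ k) 8^k≤N) ⟩
  (N ^ suc k) ^ K             ≡⟨ ^-*-assoc N (suc k) K ⟩
  N ^ (suc k * K)             ∎
  where
  open ≤-Reasoning
  M≤[8N]^K : M ≤ (8 * N) ^ K
  M≤[8N]^K = begin
    M                                   ≤⟨ M≤ ⟩
    2 ^ N * (2 ^ (K + K) * N ^ K)       ≤⟨ *-monoˡ-≤ _ (^-monoʳ-≤ 2 N≤K) ⟩
    2 ^ K * (2 ^ (K + K) * N ^ K)       ≡⟨ sym (*-assoc (2 ^ K) (2 ^ (K + K)) (N ^ K)) ⟩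
    2 ^ K * 2 ^ (K + K) * N ^ K         ≡⟨ cong (λ z → 2 ^ K * z * N ^ K) (^-distribˡ-+-* 2 K K) ⟩
    2 ^ K * (2 ^ K * 2 ^ K) * N ^ K     ≡⟨ cong (λ z → 2 ^ K * z * N ^ K) (sym (^-distribʳ-* K 2 2)) ⟩
    2 ^ K * 4 ^ K * N ^ K               ≡⟨ cong (_* N ^ K) (sym (^-distribʳ-* K 2 4)) ⟩
    8 ^ K * N ^ K                       ≡⟨ sym (^-distribʳ-* K 8 N) ⟩
    (8 * N) ^ K                         ∎

theorem14 : ∀ (d : ℕ) → 1 < d → ∀ (k : ℕ) → 1 ≤ k →
    ∃[ N₀ ] ∀ (N : ℕ) → N₀ < N →
    (N ^ ((k ∸ 1) * (N C d)) ≤ m N d ^ (k * suc d)) ×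
    (m N d ^ k ≤ N ^ (suc k * binomSum₁ N d))
theorem14 d 1<d k@(suc k′) _ = Q * n + 8 ^ k , λ N N₀<N → lower N N₀<N , upper N N₀<N
  where
  n Q : ℕ
  n = suc d
  Q = (2 * n) ^ k

  0<Q : 0 < Q
  0<Q = m^n>0 (2 * n) k

  lower : ∀ N → Q * n + 8 ^ k < N → N ^ (k′ * (N C d)) ≤ m N d ^ (k * suc d)
  lower N N₀<N = begin
    N ^ (k′ * (N C d))       ≡⟨ sym (^-*-assoc N k′ (N C d)) ⟩
    (N ^ k′) ^ (N C d)       ≤⟨ ^-monoˡ-≤ (N C d) (lower-exponent n k′ N Q≤q 0<q) ⟩
    (q ^ k) ^ (N C d)        ≡⟨ ^-exchange q k (N C d) ⟩
    (q ^ (N C d)) ^ k        ≤⟨ ^-monoˡ-≤ k (m-lower d≤N {{>-nonZero 0<q}}) ⟩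
    (m N d ^ n) ^ k          ≡⟨ ^-exchange (m N d) n k ⟩
    (m N d ^ k) ^ n          ≡⟨ ^-*-assoc (m N d) k n ⟩
    m N d ^ (k * n)          ∎
    where
    open ≤-Reasoning
    q : ℕ
    q = N / n
    Qn≤N : Q * n ≤ N
    Qn≤N = ≤-trans (m≤m+n (Q * n) (8 ^ k)) (<⇒≤ N₀<N)
    Q≤q : Q ≤ q
    Q≤q = subst (_≤ q) (m*n/n≡m Q n) (/-monoˡ-≤ n Qn≤N)
    0<q : 0 < q
    0<q = ≤-trans 0<Q Q≤q
    d≤N : d ≤ N
    d≤N = ≤-trans (n≤1+n d) (≤-trans (m≤n*m n Q {{>-nonZero 0<Q}}) Qn≤N)

  upper : ∀ N → Q * n + 8 ^ k < N → m N d ^ k ≤ N ^ (suc k * binomSum₁ N d)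
  upper N N₀<N = upper-exponent N k (N≤binomSum₁ N (<-trans (n<1+n 0) 1<d))
    (≤-trans (m≤n+m (8 ^ k) (Q * n)) (<⇒≤ N₀<N)) (m-upper N d)
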